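{- Let $\alpha$ be a simple ordered rational $k$-cone in $\mathbb{R}^n$. (1) If $i\in\{1,\ldots,k-1\}$, then for every $x\in\{1,\ldots,k-1\}$ $$\operatorname{lcos}_{x,k}(\pi_i-\alpha)=\begin{cases}\operatorname{lsin}_k\alpha-\operatorname{lcos}_{x,k}\alpha & \text{if } x=i,\\ \operatorname{lcos}_{x,k}\alpha & \text{otherwise.}\end{cases}$$ (2) If $i=k$, then for every $x\in\{1,\ldots,k-1\}$ $$\operatorname{lcos}_{x,k}(\pi_k-\alpha)=\operatorname{lsin}_k\alpha-\operatorname{lcos}_{x,k}\alpha .$$
   Context: An ordered rational $k$-cone $\alpha$ in $\mathbb{R}^n$ ($k\le n$) is given by a vertex $A_0\in\mathbb{Z}^n$ and an ordered tuple $(v_1,\ldots,v_k)$ of linearly independent primitive integer vectors (its edge vectors); as a set it is $\{A_0+\sum\lambda_iv_i:\lambda_i\ge0\}$. Let $\Gamma=\mathbb{Z}^n\cap\operatorname{span}_{\mathbb{R}}(v_1,\ldots,v_k)$. There is a unique $\mathbb{Z}$-basis $e_1,\ldots,e_k$ of $\Gamma$ such that $v_i=\sum_{j\le i}a_{j,i}e_j$ with $a_{i,i}>0$ and $0\le a_{j,i}<a_{i,i}$ for $j<i$. The upper triangular matrix $(a_{j,i})$ is denoted $\operatorname{IARCTAN}(\alpha)$ (the normalised Hermite normal form). The $i$-th integer sine is $\operatorname{lsin}_i\alpha=a_{i,i}$ and the $(j,i)$-th integer cosine ($j<i$) is $\operatorname{lcos}_{j,i}\alpha=a_{j,i}$.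 The integer sine of a rational $m$-cone $\beta$ with primitive edge vectors $w_1,\ldots,w_m$ is the index $\operatorname{lsin}(\beta)=[\mathbb{Z}^n\cap\operatorname{span}_{\mathbb{R}}(w_1,\ldots,w_m):\mathbb{Z}w_1+\cdots+\mathbb{Z}w_m]$. The cone $\alpha$ is simple if every $(k-1)$-dimensional face $\beta$ of $\alpha$ (the cone with vertex $A_0$ generated by $k-1$ of the vectors $v_i$) satisfies $\operatorname{lsin}(\beta)=1$. For $i\in\{1,\ldots,k\}$ the $i$-th adjacent cone $\pi_i-\alpha$ is the cone with the same vertex and ordered edge vectors $(v_1,\ldots,v_{i-1},-v_i,v_{i+1},\ldots,v_k)$.
   Formalization: The formula lsin_k α − lcos_{x,k} α (x = i in part 1, and part 2) is proved only when lsin_k α ≠ 1; for lsin_k α = 1 both cosines are 0 and the formula would read 0 = 1, as for the cone with edges (e_1, e_2). -}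

module Defs where

open import Data.Nat.Base using (ℕ; suc)
import Data.Nat.Divisibility as ℕ
open import Data.Integer.Base as ℤ using (ℤ; 0ℤ; ∣_∣)
open import Data.Integer.Divisibility using (_∣_)
import Data.Integer.Properties as ℤ
open import Data.Rational.Base as ℚ using (ℚ; 0ℚ)
import Data.Rational.Properties as ℚ
import Algebra.Properties.Group ℚ.+-0-group as ℚG
open import Data.Fin.Base as Fin using (Fin; punchIn)
open import Data.Fin.Properties using (_≟_)
open import Data.Product.Base using (∃; _,_)
open import Data.Vec.Functional using (Vector; removeAt; updateAt; insertAt)
open import Data.Vec.Functional.Properties
  using (updateAt-updates; updateAt-minimal; insertAt-lookup; insertAt-punchIn)
open import Function.Base using (const; _∘_)
open import Level using (0ℓ)
open import Relation.Nullary using (yes; no)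
open import Relation.Unary using (Pred; _∈_)
open import Relation.Binary.PropositionalEquality
  using (_≡_; _≗_; refl; sym; trans; cong; cong₂; subst; module ≡-Reasoning)
open import Algebra.Bundles using (CommutativeRing)

module ℤΣ where
  open import Algebra.Properties.Semiring.Sum
    (CommutativeRing.semiring ℤ.+-*-commutativeRing) public

module ℚΣ where
  open import Algebra.Properties.Semiring.Sum
    (CommutativeRing.semiring ℚ.+-*-commutativeRing) public

------------------------------------------------------------------------
-- Linear algebra over ℤ and ℚ

toℚ : ℤ → ℚ
toℚ z = z ℚ./ 1

combℤ : ∀ {n k} → Vector ℤ k → Vector (Vector ℤ n) k → Vector ℤ n
combℤ c v p = ℤΣ.sum (λ i → c i ℤ.* v i p)

combℚ : ∀ {n k} → Vector ℚ k → Vector (Vector ℤ n) k → Vector ℚ n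
combℚ c v p = ℚΣ.sum (λ i → c i ℚ.* toℚ (v i p))

-- For integer vectors, linear independence over ℚ and over ℝ coincide.
LinearlyIndependent : ∀ {n k} → Vector (Vector ℤ n) k → Set
LinearlyIndependent v =
  ∀ c → combℚ c v ≗ const 0ℚ → c ≗ const 0ℚ

Primitive : ∀ {n} → Vector ℤ n → Set
Primitive u = ∀ (d : ℤ) → (∀ p → d ∣ u p) → ∣ d ∣ ≡ 1

ℤ-Span : ∀ {n k} → Vector (Vector ℤ n) k → Pred (Vector ℤ n) 0ℓ
ℤ-Span v u = ∃ λ c → u ≗ combℤ c v

-- Γ v is ℤⁿ ∩ span(v₁,…,vₖ).  An integer vector lies in the real span of
-- integer vectors exactly when it lies in their rational span.
Γ : ∀ {n k} → Vector (Vector ℤ n) k → Pred (Vector ℤ n) 0ℓ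
Γ v u = ∃ λ c → toℚ ∘ u ≗ combℚ c v

record IsBasis {n k} (G : Pred (Vector ℤ n) 0ℓ)
               (e : Vector (Vector ℤ n) k) : Set where
  field
    member      : ∀ i → e i ∈ G
    generating  : ∀ u → u ∈ G → u ∈ ℤ-Span e
    independent : ∀ c → combℤ c e ≗ const 0ℤ → c ≗ const 0ℤ

-- [G : H] = N, for subgroups H ⊆ G of ℤⁿ: the representatives meet each
-- coset of H in G exactly once.
record HasIndex {n} (G H : Pred (Vector ℤ n) 0ℓ) (N : ℕ) : Set where
  field
    rep        : Fin N → Vector ℤ n
    rep-member : ∀ s → rep s ∈ G
    covering   : ∀ u → u ∈ G → ∃ λ s → (λ p → u p ℤ.- rep s p) ∈ H
    distinct   : ∀ s t → (λ p → rep s p ℤ.- rep t p) ∈ H → s ≡ t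

------------------------------------------------------------------------
-- Cones

-- k ≤ n is not a field since it follows from linear independence.
record Cone (n k : ℕ) : Set where
  field
    vertex      : Vector ℤ n
    edge        : Vector (Vector ℤ n) k
    edge-prim   : ∀ i → Primitive (edge i)
    independent : LinearlyIndependent edge

open Cone

IntegerSine : ∀ {n k} → Cone n k → ℕ → Set
IntegerSine β N = HasIndex (Γ (edge β)) (ℤ-Span (edge β)) N

private
  removeAt-independent : ∀ {n m} (v : Vector (Vector ℤ n) (suc m)) i →
    LinearlyIndependent v → LinearlyIndependent (removeAt v i)
  removeAt-independent v i ind c c≡0 j =
    trans (sym (insertAt-punchIn c i 0ℚ j)) (ind c⁺ c⁺≡0 (punchIn i j))
    where
    c⁺ = insertAt c i 0ℚ
    c⁺≡0 : combℚ c⁺ v ≗ const 0ℚ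
    c⁺≡0 p = begin
      combℚ c⁺ v p
        ≡⟨ ℚΣ.sum-remove {i = i} (λ j → c⁺ j ℚ.* toℚ (v j p)) ⟩
      c⁺ i ℚ.* toℚ (v i p) ℚ.+
        ℚΣ.sum (λ j → c⁺ (punchIn i j) ℚ.* toℚ (v (punchIn i j) p))
        ≡⟨ cong₂ ℚ._+_
             (trans (cong (ℚ._* toℚ (v i p)) (insertAt-lookup c i 0ℚ))
                    (ℚ.*-zeroˡ (toℚ (v i p))))
             (ℚΣ.sum-cong-≗ (λ j →
               cong (ℚ._* toℚ (v (punchIn i j) p)) (insertAt-punchIn c i 0ℚ j))) ⟩
      0ℚ ℚ.+ combℚ c (removeAt v i) p
        ≡⟨ ℚ.+-identityˡ _ ⟩
      combℚ c (removeAt v i) p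
        ≡⟨ c≡0 p ⟩
      0ℚ ∎
      where open ≡-Reasoning

  toℚ-neg : ∀ z → toℚ (ℤ.- z) ≡ ℚ.- toℚ z
  toℚ-neg (ℤ.+ 0)       = refl
  toℚ-neg (ℤ.+ (suc _)) = refl
  toℚ-neg ℤ.-[1+ m ]    = sym (ℚG.⁻¹-involutive (toℚ (ℤ.+ (suc m))))

negate : ∀ {n} → Vector ℤ n → Vector ℤ n
negate u p = ℤ.- u p

private
  negate-primitive : ∀ {n} (u : Vector ℤ n) → Primitive u → Primitive (negate u)
  negate-primitive u prim d d∣-u =
    prim d (λ p → subst (ℕ._∣_ ∣ d ∣) (ℤ.∣-i∣≡∣i∣ (u p)) (d∣-u p))

  updateAt-primitive : ∀ {n k} (v : Vector (Vector ℤ n) k) i →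
    (∀ j → Primitive (v j)) → ∀ j → Primitive (updateAt v i negate j)
  updateAt-primitive v i prim j with j ≟ i
  ... | yes refl = subst Primitive (sym (updateAt-updates i v))
                     (negate-primitive (v i) (prim i))
  ... | no  j≢i  = subst Primitive (sym (updateAt-minimal j i v j≢i)) (prim j)

  updateAt-independent : ∀ {n k} (v : Vector (Vector ℤ n) k) i →
    LinearlyIndependent v → LinearlyIndependent (updateAt v i negate)
  updateAt-independent {n} {k} v i ind c c≡0 j = c-zero
    where
    c⁻ = updateAt c i (ℚ.-_)

    term : ∀ p j → c⁻ j ℚ.* toℚ (v j p) ≡ c j ℚ.* toℚ (updateAt v i negate j p)
    term p j with j ≟ i
    ... | yes refl = begin
      c⁻ i ℚ.* toℚ (v i p)            ≡⟨ cong (ℚ._* _) (updateAt-updates i c) ⟩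
      ℚ.- c i ℚ.* toℚ (v i p)         ≡⟨ ℚ.neg-distribˡ-* (c i) _ ⟨
      ℚ.- (c i ℚ.* toℚ (v i p))       ≡⟨ ℚ.neg-distribʳ-* (c i) _ ⟩
      c i ℚ.* (ℚ.- toℚ (v i p))       ≡⟨ cong (c i ℚ.*_) (toℚ-neg (v i p)) ⟨
      c i ℚ.* toℚ (negate (v i) p)
        ≡⟨ cong (λ w → c i ℚ.* toℚ (w p)) (updateAt-updates i v) ⟨
      c i ℚ.* toℚ (updateAt v i negate i p) ∎
      where open ≡-Reasoning
    ... | no j≢i = cong₂ (λ x w → x ℚ.* toℚ (w p))
                     (updateAt-minimal j i c j≢i)
                     (sym (updateAt-minimal j i v j≢i))

    c⁻-zero : c⁻ j ≡ 0ℚ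
    c⁻-zero = ind c⁻ (λ p → trans (ℚΣ.sum-cong-≗ (term p)) (c≡0 p)) j

    c-zero : c j ≡ 0ℚ
    c-zero with j ≟ i
    ... | yes refl = trans (sym (ℚG.⁻¹-involutive (c i)))
                       (cong ℚ.-_ (trans (sym (updateAt-updates i c)) c⁻-zero))
    ... | no  j≢i  = trans (sym (updateAt-minimal j i c j≢i)) c⁻-zero

facet : ∀ {n m} → Cone n (suc m) → Fin (suc m) → Cone n m
facet α i = record
  { vertex      = vertex α
  ; edge        = removeAt (edge α) i
  ; edge-prim   = λ j → edge-prim α (punchIn i j)
  ; independent = removeAt-independent (edge α) i (independent α)
  }

Simple : ∀ {n m} → Cone n (suc m) → Set
Simple α = ∀ i → IntegerSine (facet α i) 1

π_−_ : ∀ {n k} → Fin k → Cone n k → Cone n k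
π i − α = record
  { vertex      = vertex α
  ; edge        = updateAt (edge α) i negate
  ; edge-prim   = updateAt-primitive (edge α) i (edge-prim α)
  ; independent = updateAt-independent (edge α) i (independent α)
  }

------------------------------------------------------------------------
-- Normalised Hermite normal form

-- The matrix entry a_{j,i} is `entry j i`; the basis and the entries are
-- uniquely determined by the cone.
record IARCTAN {n k} (α : Cone n k) : Set where
  field
    basis        : Vector (Vector ℤ n) k
    isBasis      : IsBasis (Γ (edge α)) basis
    entry        : Fin k → Fin k → ℤ
    expansion    : ∀ i → edge α i ≗ combℤ (λ j → entry j i) basis
    triangular   : ∀ {j i} → i Fin.< j → entry j i ≡ 0ℤ
    diagonal-pos : ∀ i → 0ℤ ℤ.< entry i i
    reduced-≥0   : ∀ {j i} → j Fin.< i → 0ℤ ℤ.≤ entry j i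
    reduced-<    : ∀ {j i} → j Fin.< i → entry j i ℤ.< entry i i

lsin : ∀ {n k} {α : Cone n k} → IARCTAN α → Fin k → ℤ
lsin A i = IARCTAN.entry A i i

-- Meaningful as an integer cosine for j < i.
lcos : ∀ {n k} {α : Cone n k} → IARCTAN α → Fin k → Fin k → ℤ
lcos A j i = IARCTAN.entry A j i

{-# OPTIONS --safe #-}
module Submission where

-- Since the facet (v₁,…,vₖ₋₁) has integer sine 1, the Hermite basis has eⱼ = vⱼ
-- for j < k, so that vₖ = Σ aⱼ vⱼ + N eₖ with N = lsin_k.  The adjacent cone spans
-- the same lattice, with signs sⱼ = ±1 on the edges, and expanding its last basis
-- vector in e gives sₖ N = M cₖ and sₖ aⱼ = M cⱼ + sⱼ bⱼ.  Exchanging the roles of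
-- the cones yields M = N, hence bⱼ ≡ ±aⱼ mod N, which determines bⱼ in [0, N).
-- Finally aⱼ = 0 would put N eₖ in the span of the facet without vⱼ with
-- coefficient 1 at vₖ, forcing N = 1.

open import Defs
open import Data.Nat.Base using (ℕ; suc)
import Data.Nat.Base as ℕ
import Data.Nat.Divisibility as ℕ
import Data.Nat.Properties as ℕ
open import Data.Fin.Base as Fin using (Fin; zero; suc; inject₁; fromℕ)
import Data.Fin.Properties as Fin
open import Data.Fin.Induction using (<-wellFounded)
open import Data.Integer.Base as ℤ
  using (ℤ; 0ℤ; 1ℤ; -1ℤ; _+_; _*_; _-_; -_; _≤_; _<_; ∣_∣; +<+)
import Data.Integer.Properties as ℤ
open import Data.Integer.Divisibility.Signed
  using (_∣_; divides; ∣⇒∣ᵤ; ∣-refl; ∣m⇒∣-m; ∣m∣n⇒∣m-n)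
open import Data.Integer.Tactic.RingSolver using (solve-∀)
open import Data.Product.Base using (_×_; _,_; ∃; proj₁; proj₂)
open import Data.Rational.Base as ℚ using (ℚ; 1ℚ)
import Data.Rational.Properties as ℚ
import Data.Rational.Unnormalised.Base as ℚᵘ
import Data.Rational.Unnormalised.Properties as ℚᵘ
open import Data.Vec.Functional using (Vector; removeAt; updateAt; insertAt)
open import Data.Vec.Functional.Properties
  using (updateAt-updates; updateAt-minimal; insertAt-lookup;
         removeAt-insertAt)
open import Function.Base using (const; _∘_)
open import Induction.WellFounded using (Acc; acc)
open import Relation.Binary.PropositionalEquality
  using (_≡_; _≢_; _≗_; refl; sym; trans; cong; cong₂; subst; ≢-sym;
         module ≡-Reasoning)
open import Relation.Binary.Definitions using (tri<; tri≈; tri>)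
open import Relation.Nullary using (yes; no; contradiction)
open import Relation.Unary using (_∈_)

open ≡-Reasoning
open Cone
open IARCTAN

private variable
  n k m : ℕ

-- The embedding of the integers in the rationals.

-- `toℚ` normalises its fraction and does not reduce on variables, so the identity is checked by
-- cross-multiplying unnormalised fractions.
toℚ-+ : ∀ a b → toℚ (a + b) ≡ toℚ a ℚ.+ toℚ b
toℚ-+ a b = ℚ.toℚᵘ-injective (ℚᵘ.≃-trans (ℚ.toℚᵘ-fromℚᵘ (ℚᵘ.mkℚᵘ (a + b) 0))
  (ℚᵘ.≃-trans (ℚᵘ.*≡* (cong (_* 1ℤ) (sym (cong₂ _+_ (ℤ.*-identityʳ a) (ℤ.*-identityʳ b)))))
  (ℚᵘ.≃-sym (ℚᵘ.≃-trans (ℚ.toℚᵘ-homo-+ (toℚ a) (toℚ b))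
    (ℚᵘ.+-cong (ℚ.toℚᵘ-fromℚᵘ (ℚᵘ.mkℚᵘ a 0)) (ℚ.toℚᵘ-fromℚᵘ (ℚᵘ.mkℚᵘ b 0)))))))

toℚ-* : ∀ a b → toℚ (a * b) ≡ toℚ a ℚ.* toℚ b
toℚ-* a b = ℚ.toℚᵘ-injective (ℚᵘ.≃-trans (ℚ.toℚᵘ-fromℚᵘ (ℚᵘ.mkℚᵘ (a * b) 0))
  (ℚᵘ.≃-sym (ℚᵘ.≃-trans (ℚ.toℚᵘ-homo-* (toℚ a) (toℚ b))
    (ℚᵘ.*-cong (ℚ.toℚᵘ-fromℚᵘ (ℚᵘ.mkℚᵘ a 0)) (ℚ.toℚᵘ-fromℚᵘ (ℚᵘ.mkℚᵘ b 0))))))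

toℚ-injective : ∀ {a b} → toℚ a ≡ toℚ b → a ≡ b
toℚ-injective {a} {b} eq with ℚ.fromℚᵘ-injective {ℚᵘ.mkℚᵘ a 0} {ℚᵘ.mkℚᵘ b 0} eq
... | ℚᵘ.*≡* a*1≡b*1 = ℤ.*-cancelʳ-≡ a b 1ℤ a*1≡b*1

-- Integer linear combinations.

combℤ-congˡ : ∀ {c d : Vector ℤ k} (v : Vector (Vector ℤ n) k) →
  c ≗ d → combℤ c v ≗ combℤ d v
combℤ-congˡ v c≗d p = ℤΣ.sum-cong-≗ (λ j → cong (_* v j p) (c≗d j))

combℤ-+ : ∀ (c d : Vector ℤ k) (v : Vector (Vector ℤ n) k) p →
  combℤ (λ j → c j + d j) v p ≡ combℤ c v p + combℤ d v p
combℤ-+ c d v p = trans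
  (ℤΣ.sum-cong-≗ (λ j → ℤ.*-distribʳ-+ (v j p) (c j) (d j)))
  (ℤΣ.∑-distrib-+ (λ j → c j * v j p) (λ j → d j * v j p))

combℤ-* : ∀ t (c : Vector ℤ k) (v : Vector (Vector ℤ n) k) p →
  combℤ (λ j → t * c j) v p ≡ t * combℤ c v p
combℤ-* t c v p = trans
  (ℤΣ.sum-cong-≗ (λ j → ℤ.*-assoc t (c j) (v j p)))
  (sym (ℤΣ.*-distribˡ-sum t (λ j → c j * v j p)))

combℤ-- : ∀ (c d : Vector ℤ k) (v : Vector (Vector ℤ n) k) p →
  combℤ (λ j → c j - d j) v p ≡ combℤ c v p - combℤ d v p
combℤ-- c d v p = begin
  combℤ (λ j → c j - d j) v p
    ≡⟨ combℤ-congˡ v (λ j → cong (c j +_) (ℤ.-1*i≡-i (d j))) p ⟨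
  combℤ (λ j → c j + -1ℤ * d j) v p
    ≡⟨ combℤ-+ c (λ j → -1ℤ * d j) v p ⟩
  combℤ c v p + combℤ (λ j → -1ℤ * d j) v p
    ≡⟨ cong (combℤ c v p +_) (trans (combℤ-* -1ℤ d v p) (ℤ.-1*i≡-i _)) ⟩
  combℤ c v p - combℤ d v p ∎

combℤ-0 : ∀ (v : Vector (Vector ℤ n) k) → combℤ (const 0ℤ) v ≗ const 0ℤ
combℤ-0 v = combℤ-* 0ℤ (const 0ℤ) v

_[_]≔0 : Vector ℤ k → Fin k → Vector ℤ k
c [ i ]≔0 = updateAt c i (const 0ℤ)

combℤ-isolate : ∀ (c : Vector ℤ k) i (v : Vector (Vector ℤ n) k) p →
  combℤ c v p ≡ c i * v i p + combℤ (c [ i ]≔0) v p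
combℤ-isolate c zero v p =
  cong (λ s → c zero * v zero p + s) (sym (ℤ.+-identityˡ _))
combℤ-isolate c (suc i) v p = begin
  c zero * v zero p + combℤ (c ∘ suc) (v ∘ suc) p
    ≡⟨ cong (c zero * v zero p +_) (combℤ-isolate (c ∘ suc) i (v ∘ suc) p) ⟩
  c zero * v zero p + (c (suc i) * v (suc i) p + rest)
    ≡⟨ swap (c zero * v zero p) (c (suc i) * v (suc i) p) rest ⟩
  c (suc i) * v (suc i) p + (c zero * v zero p + rest) ∎
  where
  rest = combℤ ((c ∘ suc) [ i ]≔0) (v ∘ suc) p
  swap : ∀ x y z → x + (y + z) ≡ y + (x + z)
  swap = solve-∀

δ : Fin k → Vector ℤ k
δ i = updateAt (const 0ℤ) i (const 1ℤ)

combℤ-δ : ∀ i (v : Vector (Vector ℤ n) k) → combℤ (δ i) v ≗ v i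
combℤ-δ zero v p = begin
  1ℤ * v zero p + combℤ (const 0ℤ) (v ∘ suc) p
    ≡⟨ cong₂ _+_ (ℤ.*-identityˡ (v zero p)) (combℤ-0 (v ∘ suc) p) ⟩
  v zero p + 0ℤ ≡⟨ ℤ.+-identityʳ _ ⟩
  v zero p      ∎
combℤ-δ (suc i) v p = trans (ℤ.+-identityˡ _) (combℤ-δ i (v ∘ suc) p)

combℤ-scale : ∀ (s c : Vector ℤ k) {v w : Vector (Vector ℤ n) k} →
  (∀ j p → w j p ≡ s j * v j p) → combℤ c w ≗ combℤ (λ j → c j * s j) v
combℤ-scale s c {v} w≡sv p = ℤΣ.sum-cong-≗ (λ j →
  trans (cong (c j *_) (w≡sv j p)) (sym (ℤ.*-assoc (c j) (s j) (v j p))))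

-- A vector with coefficient 0 may be replaced freely. For a triangular column this leaves only the
-- indices before the diagonal to be compared.
combℤ-support : ∀ (c : Vector ℤ k) {v w : Vector (Vector ℤ n) k} i →
  (∀ j → j ≢ i → c j ≢ 0ℤ → v j ≗ w j) →
  combℤ (c [ i ]≔0) v ≗ combℤ (c [ i ]≔0) w
combℤ-support c {v} {w} i agree p = ℤΣ.sum-cong-≗ term
  where
  term : ∀ j → (c [ i ]≔0) j * v j p ≡ (c [ i ]≔0) j * w j p
  term j with j Fin.≟ i
  ... | yes refl rewrite updateAt-updates i {f = const 0ℤ} c = refl
  ... | no j≢i rewrite updateAt-minimal j i {f = const 0ℤ} c j≢i
      with c j ℤ.≟ 0ℤ
  ...   | yes cj≡0 rewrite cj≡0 = refl
  ...   | no cj≢0 = cong (c j *_) (agree j j≢i cj≢0 p)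

combℤ-removeAt : ∀ (c : Vector ℤ (suc m)) (v : Vector (Vector ℤ n) (suc m)) z →
  c z ≡ 0ℤ → combℤ c v ≗ combℤ (removeAt c z) (removeAt v z)
combℤ-removeAt c v z cz≡0 p = begin
  combℤ c v p ≡⟨ ℤΣ.sum-remove {i = z} (λ j → c j * v j p) ⟩
  c z * v z p + rest ≡⟨ cong (λ x → x * v z p + rest) cz≡0 ⟩
  0ℤ + rest ≡⟨ ℤ.+-identityˡ rest ⟩
  rest ∎
  where rest = combℤ (removeAt c z) (removeAt v z) p

combℤ-insertAt : ∀ (c : Vector ℤ m) (v : Vector (Vector ℤ n) (suc m)) z →
  combℤ (insertAt c z 0ℤ) v ≗ combℤ c (removeAt v z)
combℤ-insertAt c v z p = trans
  (combℤ-removeAt (insertAt c z 0ℤ) v z (insertAt-lookup c z 0ℤ) p)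
  (combℤ-congˡ (removeAt v z) (removeAt-insertAt c z 0ℤ) p)

-- Independence over the integers and saturation of `Γ`.

toℚ-sum : ∀ (f : Vector ℤ k) → toℚ (ℤΣ.sum f) ≡ ℚΣ.sum (toℚ ∘ f)
toℚ-sum {ℕ.zero}  f = refl
toℚ-sum {suc k} f = trans (toℚ-+ (f zero) (ℤΣ.sum (f ∘ suc)))
                          (cong (toℚ (f zero) ℚ.+_) (toℚ-sum (f ∘ suc)))

toℚ-combℤ : ∀ (c : Vector ℤ k) (v : Vector (Vector ℤ n) k) →
  toℚ ∘ combℤ c v ≗ combℚ (toℚ ∘ c) v
toℚ-combℤ c v p = trans (toℚ-sum (λ j → c j * v j p))
                        (ℚΣ.sum-cong-≗ (λ j → toℚ-* (c j) (v j p)))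

ℤ-Independent : Vector (Vector ℤ n) k → Set
ℤ-Independent v = ∀ c → combℤ c v ≗ const 0ℤ → c ≗ const 0ℤ

independent⇒ℤ-independent : ∀ (v : Vector (Vector ℤ n) k) →
  LinearlyIndependent v → ℤ-Independent v
independent⇒ℤ-independent v ind c c≡0 j = toℚ-injective
  (ind (toℚ ∘ c) (λ p → trans (sym (toℚ-combℤ c v p)) (cong toℚ (c≡0 p))) j)

combℤ-injective : ∀ (v : Vector (Vector ℤ n) k) → ℤ-Independent v →
  ∀ c d → combℤ c v ≗ combℤ d v → c ≗ d
combℤ-injective v ind c d eq j = ℤ.i-j≡0⇒i≡j (c j) (d j)
  (ind (λ j → c j - d j)
       (λ p → trans (combℤ-- c d v p) (ℤ.i≡j⇒i-j≡0 (eq p))) j)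

-- Coefficients in `Γ` are rational, so the relation can be divided by `d`.
Γ-saturated : ∀ (v : Vector (Vector ℤ n) k) c d u → d ≢ 0ℤ →
  (∀ p → d * u p ≡ combℤ c v p) → u ∈ Γ v
Γ-saturated v c d u d≢0 du≡cv = (λ j → r ℚ.* toℚ (c j)) , λ p → begin
  toℚ (u p)                         ≡⟨ ℚ.*-identityˡ _ ⟨
  1ℚ ℚ.* toℚ (u p)                  ≡⟨ cong (ℚ._* toℚ (u p)) (ℚ.*-inverseˡ (toℚ d)) ⟨
  r ℚ.* toℚ d ℚ.* toℚ (u p)         ≡⟨ ℚ.*-assoc r (toℚ d) (toℚ (u p)) ⟩
  r ℚ.* (toℚ d ℚ.* toℚ (u p))       ≡⟨ cong (r ℚ.*_) (toℚ-* d (u p)) ⟨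
  r ℚ.* toℚ (d * u p)               ≡⟨ cong (λ x → r ℚ.* toℚ x) (du≡cv p) ⟩
  r ℚ.* toℚ (combℤ c v p)           ≡⟨ cong (r ℚ.*_) (toℚ-combℤ c v p) ⟩
  r ℚ.* combℚ (toℚ ∘ c) v p
    ≡⟨ ℚΣ.*-distribˡ-sum r (λ j → toℚ (c j) ℚ.* toℚ (v j p)) ⟩
  ℚΣ.sum (λ j → r ℚ.* (toℚ (c j) ℚ.* toℚ (v j p)))
    ≡⟨ ℚΣ.sum-cong-≗ (λ j → ℚ.*-assoc r (toℚ (c j)) (toℚ (v j p))) ⟨
  combℚ (λ j → r ℚ.* toℚ (c j)) v p ∎
  where
  instance
    d-nonZero : ℚ.NonZero (toℚ d)
    d-nonZero = ℚ.≢-nonZero (d≢0 ∘ toℚ-injective)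
  r = ℚ.1/ toℚ d

Γ-scale : ∀ (s : Vector ℤ k) {v w : Vector (Vector ℤ n) k} →
  (∀ j p → w j p ≡ s j * v j p) → ∀ u → u ∈ Γ w → u ∈ Γ v
Γ-scale s {v} w≡sv u (c , u≡cw) = (λ j → c j ℚ.* toℚ (s j)) , λ p →
  trans (u≡cw p) (ℚΣ.sum-cong-≗ (λ j →
    trans (cong (c j ℚ.*_) (trans (cong toℚ (w≡sv j p)) (toℚ-* (s j) (v j p))))
          (sym (ℚ.*-assoc (c j) (toℚ (s j)) (toℚ (v j p))))))

0∈Γ : ∀ (v : Vector (Vector ℤ n) k) → const 0ℤ ∈ Γ v
0∈Γ v = Γ-saturated v (const 0ℤ) 1ℤ (const 0ℤ) (λ ()) (λ p → sym (combℤ-0 v p))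

-- Facets of integer sine 1.

-- The only representative need not be 0, but 0 lies in its coset too; subtracting the two
-- memberships cancels it.
index-1⇒span : ∀ (v : Vector (Vector ℤ n) k) → HasIndex (Γ v) (ℤ-Span v) 1 →
  ∀ u → u ∈ Γ v → u ∈ ℤ-Span v
index-1⇒span v index u u∈Γ
  with HasIndex.covering index u u∈Γ | HasIndex.covering index (const 0ℤ) (0∈Γ v)
... | zero , c , u-r≡cv | zero , d , 0-r≡dv = (λ j → c j - d j) , λ p → begin
  u p                               ≡⟨ cancel (u p) (rep zero p) ⟨
  (u p - rep zero p) - (0ℤ - rep zero p) ≡⟨ cong₂ _-_ (u-r≡cv p) (0-r≡dv p) ⟩
  combℤ c v p - combℤ d v p         ≡⟨ combℤ-- c d v p ⟨
  combℤ (λ j → c j - d j) v p       ∎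
  where
  open HasIndex index using (rep)
  cancel : ∀ x y → (x - y) - (0ℤ - y) ≡ x
  cancel = solve-∀

-- For independent v: every facet of the cone spanned by v has integer sine 1.
FacetDivisible : Vector (Vector ℤ n) k → Set
FacetDivisible {n} v = ∀ z c d (u : Vector ℤ n) → c z ≡ 0ℤ → d ≢ 0ℤ →
  (∀ p → d * u p ≡ combℤ c v p) → ∀ j → d ∣ c j

-- By saturation `u` lies in the lattice of the facet without the edge `z`, hence is an integer
-- combination of that facet's edges. Independence then identifies `c` with `d` times its
-- coefficients.
simple⇒facetDivisible : ∀ (α : Cone n (suc m)) → Simple α → FacetDivisible (edge α)
simple⇒facetDivisible α simple z c d u cz≡0 d≢0 du≡cv j
  with index-1⇒span (removeAt (edge α) z) (simple z) u
         (Γ-saturated (removeAt (edge α) z) (removeAt c z) d u d≢0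
           (λ p → trans (du≡cv p) (combℤ-removeAt c (edge α) z cz≡0 p)))
... | b , u≡bv = divides (insertAt b z 0ℤ j) (trans
  (combℤ-injective (edge α) (independent⇒ℤ-independent (edge α) (independent α))
    c (λ i → d * insertAt b z 0ℤ i) c≡db j)
  (ℤ.*-comm d (insertAt b z 0ℤ j)))
  where
  c≡db : combℤ c (edge α) ≗ combℤ (λ i → d * insertAt b z 0ℤ i) (edge α)
  c≡db p = begin
    combℤ c (edge α) p ≡⟨ du≡cv p ⟨
    d * u p ≡⟨ cong (d *_) (u≡bv p) ⟩
    d * combℤ b (removeAt (edge α) z) p
      ≡⟨ cong (d *_) (combℤ-insertAt b (edge α) z p) ⟨
    d * combℤ (insertAt b z 0ℤ) (edge α) p
      ≡⟨ combℤ-* d (insertAt b z 0ℤ) (edge α) p ⟨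
    combℤ (λ i → d * insertAt b z 0ℤ i) (edge α) p ∎

∣-unit : ∀ {d} x s → s * s ≡ 1ℤ → d ∣ x * s → d ∣ x
∣-unit {d} x s s²≡1 (divides q xs≡qd) = divides (q * s) (begin
  x           ≡⟨ ℤ.*-identityʳ x ⟨
  x * 1ℤ      ≡⟨ cong (x *_) s²≡1 ⟨
  x * (s * s) ≡⟨ ℤ.*-assoc x s s ⟨
  x * s * s   ≡⟨ cong (_* s) xs≡qd ⟩
  q * d * s   ≡⟨ swap q d s ⟩
  q * s * d   ∎)
  where
  swap : ∀ a b c → a * b * c ≡ a * c * b
  swap = solve-∀

-- Signs move from the vectors into the coefficients, where they do not affect divisibility. The
-- adjacent cone thus inherits the condition with no coset representatives built for its facets.
facetDivisible-scale : ∀ (s : Vector ℤ k) → (∀ j → s j * s j ≡ 1ℤ) →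
  ∀ {v w : Vector (Vector ℤ n) k} → (∀ j p → w j p ≡ s j * v j p) →
  FacetDivisible v → FacetDivisible w
facetDivisible-scale s s²≡1 w≡sv div z c d u cz≡0 d≢0 du≡cw j =
  ∣-unit (c j) (s j) (s²≡1 j)
    (div z (λ i → c i * s i) d u (cong (_* s z) cz≡0) d≢0
      (λ p → trans (du≡cw p) (combℤ-scale s c w≡sv p)) j)

-- The Hermite basis of a cone whose facets have integer sine 1.

module _ {α : Cone n k} (A : IARCTAN α) where

  column : Fin k → Vector ℤ k
  column i j = entry A j i

  diagonal≢0 : ∀ i → entry A i i ≢ 0ℤ
  diagonal≢0 i = ≢-sym (ℤ.<⇒≢ (diagonal-pos A i))

  -- Column i reads v_i = a_{i,i} e_i + sum of a_{j,i} e_j over j < i. Replacing each such e_j by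
  -- v_j and solving for a_{i,i} e_i gives coefficient 1 at v_i and -a_{j,i} at v_j.
  diagonal-expansion : ∀ i → (∀ j → j Fin.< i → basis A j ≗ edge α j) → ∀ p →
    entry A i i * basis A i p ≡ combℤ (λ j → δ i j - (column i [ i ]≔0) j) (edge α) p
  diagonal-expansion i e≗v p = begin
    entry A i i * basis A i p
      ≡⟨ x≡[x+y]-y (entry A i i * basis A i p) (combℤ (column i [ i ]≔0) (basis A) p) ⟩
    (entry A i i * basis A i p + combℤ (column i [ i ]≔0) (basis A) p)
      - combℤ (column i [ i ]≔0) (basis A) p
      ≡⟨ cong₂ _-_ (combℤ-isolate (column i) i (basis A) p)
                   (sym (combℤ-support (column i) i agree p)) ⟨
    combℤ (column i) (basis A) p - combℤ (column i [ i ]≔0) (edge α) p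
      ≡⟨ cong (_- combℤ (column i [ i ]≔0) (edge α) p)
              (trans (combℤ-δ i (edge α) p) (expansion A i p)) ⟨
    combℤ (δ i) (edge α) p - combℤ (column i [ i ]≔0) (edge α) p
      ≡⟨ combℤ-- (δ i) (column i [ i ]≔0) (edge α) p ⟨
    combℤ (λ j → δ i j - (column i [ i ]≔0) j) (edge α) p ∎
    where
    x≡[x+y]-y : ∀ x y → x ≡ (x + y) - y
    x≡[x+y]-y = solve-∀
    agree : ∀ j → j ≢ i → column i j ≢ 0ℤ → basis A j ≗ edge α j
    agree j j≢i aji≢0 with Fin.<-cmp j i
    ... | tri< j<i _ _ = e≗v j j<i
    ... | tri≈ _ j≡i _ = contradiction j≡i j≢i
    ... | tri> _ _ i<j = contradiction (triangular A i<j) aji≢0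

  -- A zero z in column i puts a_{i,i} e_i in the span of the facet without v_z,
  -- where its coefficient at v_i is 1.
  zero⇒diagonal≡1 : FacetDivisible (edge α) → ∀ i →
    (∀ j → j Fin.< i → basis A j ≗ edge α j) →
    ∀ z → entry A z i ≡ 0ℤ → entry A i i ≡ 1ℤ
  zero⇒diagonal≡1 div i e≗v z azi≡0 = pos∣1⇒≡1 (diagonal-pos A i)
    (subst (entry A i i ∣_) cᵢ≡1
      (div z c (entry A i i) (basis A i) c-z≡0 (diagonal≢0 i)
           (diagonal-expansion i e≗v) i))
    where
    c = λ j → δ i j - (column i [ i ]≔0) j
    cᵢ≡1 : c i ≡ 1ℤ
    cᵢ≡1 = cong₂ _-_ (updateAt-updates i (const 0ℤ)) (updateAt-updates i (column i))
    z≢i : z ≢ i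
    z≢i refl = diagonal≢0 i azi≡0
    c-z≡0 : c z ≡ 0ℤ
    c-z≡0 = cong₂ _-_ (updateAt-minimal z i (const 0ℤ) z≢i)
                      (trans (updateAt-minimal z i (column i) z≢i) azi≡0)
    pos∣1⇒≡1 : ∀ {d} → 0ℤ < d → d ∣ 1ℤ → d ≡ 1ℤ
    pos∣1⇒≡1 {ℤ.+ d} _ d∣1 = cong ℤ.+_ (ℕ.∣1⇒≡1 (∣⇒∣ᵤ d∣1))

  -- Induction on `i`. Row `l` lies below the diagonal and so supplies a zero in column `i`, which
  -- forces a_{i,i} = 1. Reducedness then clears the entries above it, and the column is `δ i`.
  basis≗edge : FacetDivisible (edge α) → ∀ {l} i → i Fin.< l → basis A i ≗ edge α i
  basis≗edge div {l} i i<l = go i i<l (<-wellFounded i)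
    where
    go : ∀ i → i Fin.< l → Acc Fin._<_ i → basis A i ≗ edge α i
    go i i<l (acc rs) p = begin
      basis A i p                  ≡⟨ combℤ-δ i (basis A) p ⟨
      combℤ (δ i) (basis A) p      ≡⟨ combℤ-congˡ (basis A) δ≗column p ⟩
      combℤ (column i) (basis A) p ≡⟨ expansion A i p ⟨
      edge α i p                   ∎
      where
      aᵢᵢ≡1 : entry A i i ≡ 1ℤ
      aᵢᵢ≡1 = zero⇒diagonal≡1 div i
        (λ j j<i → go j (Fin.<-trans j<i i<l) (rs j<i)) l (triangular A i<l)
      ≥0∧<1⇒≡0 : ∀ {x} → 0ℤ ≤ x → x < 1ℤ → x ≡ 0ℤ
      ≥0∧<1⇒≡0 0≤x x<1 = ℤ.≤-antisym (ℤ.i<j⇒i≤pred[j] x<1) 0≤x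
      δ≗column : δ i ≗ column i
      δ≗column j with Fin.<-cmp j i
      ... | tri< j<i j≢i _ = trans (updateAt-minimal j i (const 0ℤ) j≢i)
              (sym (≥0∧<1⇒≡0 (reduced-≥0 A j<i)
                             (subst (entry A j i <_) aᵢᵢ≡1 (reduced-< A j<i))))
      ... | tri≈ _ refl _ = trans (updateAt-updates i (const 0ℤ)) (sym aᵢᵢ≡1)
      ... | tri> _ j≢i i<j = trans (updateAt-minimal j i (const 0ℤ) j≢i)
              (sym (triangular A i<j))

-- Residues in the interval [0, N).

-- The distance of a and b is at most their maximum, hence below N, and the only such multiple of N
-- is 0.
residue-unique : ∀ {N a b} → 0ℤ ≤ a → a < N → 0ℤ ≤ b → b < N → N ∣ a - b → a ≡ b
residue-unique {ℤ.+ N} {ℤ.+ a} {ℤ.+ b} _ (+<+ a<N) _ (+<+ b<N) N∣a-b =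
  ℤ.i-j≡0⇒i≡j (ℤ.+ a) (ℤ.+ b) (ℤ.∣i∣≡0⇒i≡0 (multiple<⇒≡0 ∣a-b∣<N (∣⇒∣ᵤ N∣a-b)))
  where
  ∣a-b∣<N : ∣ ℤ.+ a - ℤ.+ b ∣ ℕ.< N
  ∣a-b∣<N rewrite ℤ.m-n≡m⊖n a b =
    ℕ.≤-<-trans (ℤ.∣m⊝n∣≤m⊔n a b) (ℕ.⊔-pres-<m a<N b<N)
  multiple<⇒≡0 : ∀ {N x} → x ℕ.< N → N ℕ.∣ x → x ≡ 0
  multiple<⇒≡0 {x = ℕ.zero}  _   _   = refl
  multiple<⇒≡0 {x = ℕ.suc _} x<N N∣x = contradiction N∣x (ℕ.>⇒∤ x<N)

-- Strict positivity of a places N - a below N, so both b and N - a are reduced residues.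
residue-complement : ∀ {N a b} → 0ℤ < a → a < N → 0ℤ ≤ b → b < N →
  N ∣ a + b → b ≡ N - a
residue-complement {N} {a} {b} 0<a a<N 0≤b b<N N∣a+b =
  residue-unique 0≤b b<N (ℤ.i≤j⇒0≤j-i (ℤ.<⇒≤ a<N))
    (subst (N - a <_) (ℤ.+-identityʳ N) (ℤ.+-monoʳ-< N (ℤ.neg-mono-< 0<a)))
    (subst (N ∣_) (regroup N a b) (∣m∣n⇒∣m-n N∣a+b ∣-refl))
  where
  regroup : ∀ N a b → (a + b) - N ≡ b - (N - a)
  regroup = solve-∀

∣-antisym-pos : ∀ {a b} → 0ℤ < a → 0ℤ < b → a ∣ b → b ∣ a → a ≡ b
∣-antisym-pos {ℤ.+ _} {ℤ.+ _} _ _ a∣b b∣a = cong ℤ.+_ (ℕ.∣-antisym (∣⇒∣ᵤ a∣b) (∣⇒∣ᵤ b∣a))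

-- Comparison of the last columns.

≢last⇒<last : ∀ {j} → j ≢ fromℕ m → j Fin.< fromℕ m
≢last⇒<last {j = j} = Fin.≤∧≢⇒< (Fin.≤fromℕ j)

inject₁<last : ∀ (x : Fin m) → inject₁ x Fin.< fromℕ m
inject₁<last x = ≢last⇒<last (≢-sym Fin.fromℕ≢inject₁)

-- Expanding the last basis vector of B in the basis of A compares the last
-- columns of the two matrices.
last-column-compare : ∀ {α β : Cone n (suc m)} (A : IARCTAN α) (B : IARCTAN β) →
  FacetDivisible (edge α) → FacetDivisible (edge β) →
  ∀ s → (∀ j p → edge β j p ≡ s j * edge α j p) →
  let k = fromℕ m in
  ∃ λ c → ∀ l → s k * entry A l k ≡ lsin B k * c l + (column B k [ k ]≔0) l * s l
last-column-compare {m = m} {α} {β} A B div-α div-β s w≡sv =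
  -- Both sides are the coordinates in `e` of the last edge of `β`.
  c , combℤ-injective e (IsBasis.independent (isBasis A))
    (λ l → s last * a l) (λ l → M * c l + b⁰ l * s l) λ p → begin
    combℤ (λ l → s last * a l) e p  ≡⟨ combℤ-* (s last) a e p ⟩
    s last * combℤ a e p            ≡⟨ cong (s last *_) (expansion A last p) ⟨
    s last * edge α last p             ≡⟨ w≡sv last p ⟨
    edge β last p                   ≡⟨ expansion B last p ⟩
    combℤ (column B last) f p       ≡⟨ combℤ-isolate (column B last) last f p ⟩
    M * f last p + combℤ b⁰ f p
      ≡⟨ cong₂ _+_ (trans (cong (M *_) (fₖ≡ce p)) (sym (combℤ-* M c e p)))
                   -- Before the last index both bases consist of edges, so they differ only by the
                   -- factors `s`.
                   (trans (combℤ-support (column B last) last f≡se p)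
                          (combℤ-scale s b⁰ {v = e} (λ j q → refl) p)) ⟩
    combℤ (λ l → M * c l) e p + combℤ (λ l → b⁰ l * s l) e p
      ≡⟨ combℤ-+ (λ l → M * c l) (λ l → b⁰ l * s l) e p ⟨
    combℤ (λ l → M * c l + b⁰ l * s l) e p ∎
  where
  last = fromℕ m
  a = column A last
  e = basis A
  f = basis B
  M = lsin B last
  b⁰ = column B last [ last ]≔0
  fₖ∈⟨e⟩ : f last ∈ ℤ-Span e
  fₖ∈⟨e⟩ = IsBasis.generating (isBasis A) (f last)
    (Γ-scale s w≡sv (f last) (IsBasis.member (isBasis B) last))
  c = proj₁ fₖ∈⟨e⟩
  fₖ≡ce = proj₂ fₖ∈⟨e⟩
  f≡se : ∀ j → j ≢ last → column B last j ≢ 0ℤ → f j ≗ λ q → s j * e j q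
  f≡se j j≢last _ q = begin
    f j q            ≡⟨ basis≗edge B div-β j (≢last⇒<last j≢last) q ⟩
    edge β j q       ≡⟨ w≡sv j q ⟩
    s j * edge α j q ≡⟨ cong (s j *_) (basis≗edge A div-α j (≢last⇒<last j≢last) q) ⟨
    s j * e j q      ∎

module _ {α β : Cone n (suc m)} (A : IARCTAN α) (B : IARCTAN β)
         (div-α : FacetDivisible (edge α)) (div-β : FacetDivisible (edge β))
         (s : Vector ℤ (suc m)) (w≡sv : ∀ j p → edge β j p ≡ s j * edge α j p) where

  private
    l  = fromℕ m
    b⁰ = column B l [ l ]≔0
    c  = proj₁ (last-column-compare A B div-α div-β s w≡sv)

    compare : ∀ x → s l * entry A x l ≡ lsin B l * c x + b⁰ x * s x
    compare = proj₂ (last-column-compare A B div-α div-β s w≡sv)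

  -- In the last row the cleared coefficient drops out, leaving s_k N = M c_k.
  last-lsin-∣ : s l * s l ≡ 1ℤ → lsin B l ∣ lsin A l
  last-lsin-∣ s²≡1 = ∣-unit (lsin A l) (s l) s²≡1 (divides (c l) (begin
    lsin A l * s l ≡⟨ ℤ.*-comm (lsin A l) (s l) ⟩
    s l * lsin A l ≡⟨ compare l ⟩
    lsin B l * c l + b⁰ l * s l
      ≡⟨ cong (λ x → lsin B l * c l + x * s l) (updateAt-updates l (column B l)) ⟩
    lsin B l * c l + 0ℤ ≡⟨ ℤ.+-identityʳ (lsin B l * c l) ⟩
    lsin B l * c l      ≡⟨ ℤ.*-comm (lsin B l) (c l) ⟩
    c l * lsin B l      ∎))

  -- In the other rows clearing changes nothing, and M c_x is exactly the difference.
  last-lcos-congruent : ∀ x → x ≢ l →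
    lsin B l ∣ s l * lcos A x l - lcos B x l * s x
  last-lcos-congruent x x≢l = divides (c x) (begin
    s l * lcos A x l - lcos B x l * s x
      ≡⟨ cong (_- lcos B x l * s x) (compare x) ⟩
    lsin B l * c x + b⁰ x * s x - lcos B x l * s x
      ≡⟨ cong (λ y → lsin B l * c x + y * s x - lcos B x l * s x)
              (updateAt-minimal x l (column B l) x≢l) ⟩
    lsin B l * c x + lcos B x l * s x - lcos B x l * s x
      ≡⟨ x*y+z-z≡y*x (lsin B l) (c x) (lcos B x l * s x) ⟩
    c x * lsin B l ∎)
    where
    x*y+z-z≡y*x : ∀ x y z → x * y + z - z ≡ y * x
    x*y+z-z≡y*x = solve-∀

-- Signs of the adjacent cone.

flip : Fin k → Vector ℤ k
flip i = updateAt (const 1ℤ) i (const -1ℤ)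

flip-self : ∀ (i : Fin k) → flip i i ≡ -1ℤ
flip-self i = updateAt-updates i (const 1ℤ)

flip-other : ∀ {i j : Fin k} → j ≢ i → flip i j ≡ 1ℤ
flip-other {i = i} {j} j≢i = updateAt-minimal j i (const 1ℤ) j≢i

flip-square : ∀ (i j : Fin k) → flip i j * flip i j ≡ 1ℤ
flip-square i j with j Fin.≟ i
... | yes refl = cong (λ x → x * x) (flip-self i)
... | no j≢i   = cong (λ x → x * x) (flip-other j≢i)

edge-π : ∀ (α : Cone n k) i j p → edge (π i − α) j p ≡ flip i j * edge α j p
edge-π α i j p with j Fin.≟ i
... | yes refl = begin
  edge (π i − α) i p      ≡⟨ cong (λ u → u p) (updateAt-updates i (edge α)) ⟩
  - edge α i p            ≡⟨ ℤ.-1*i≡-i (edge α i p) ⟨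
  -1ℤ * edge α i p        ≡⟨ cong (_* edge α i p) (flip-self i) ⟨
  flip i i * edge α i p   ∎
... | no j≢i = begin
  edge (π i − α) j p      ≡⟨ cong (λ u → u p) (updateAt-minimal j i (edge α) j≢i) ⟩
  edge α j p              ≡⟨ ℤ.*-identityˡ (edge α j p) ⟨
  1ℤ * edge α j p         ≡⟨ cong (_* edge α j p) (flip-other j≢i) ⟨
  flip i j * edge α j p   ∎

-- The last cosines of the adjacent cone.

module _ (α : Cone n (suc m)) (simple : Simple α) (A : IARCTAN α)
         (i : Fin (suc m)) (B : IARCTAN (π i − α)) (x : Fin m) where

  private
    l = fromℕ m
    y = inject₁ x
    s = flip i
    w≡sv = edge-π α i

    -- The signs are self-inverse, so the comparison also applies with the two cones exchanged.
    v≡sw : ∀ j p → edge α j p ≡ s j * edge (π i − α) j p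
    v≡sw j p = begin
      edge α j p                     ≡⟨ ℤ.*-identityˡ _ ⟨
      1ℤ * edge α j p                ≡⟨ cong (_* edge α j p) (flip-square i j) ⟨
      s j * s j * edge α j p         ≡⟨ ℤ.*-assoc (s j) (s j) (edge α j p) ⟩
      s j * (s j * edge α j p)       ≡⟨ cong (s j *_) (w≡sv j p) ⟨
      s j * edge (π i − α) j p       ∎

    div-α = simple⇒facetDivisible α simple
    div-β = facetDivisible-scale s (flip-square i) w≡sv div-α

    N≡M : lsin A l ≡ lsin B l
    N≡M = ∣-antisym-pos (diagonal-pos A l) (diagonal-pos B l)
      (last-lsin-∣ B A div-β div-α s v≡sw (flip-square i l))
      (last-lsin-∣ A B div-α div-β s w≡sv (flip-square i l))

    0≤b : 0ℤ ≤ lcos B y l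
    0≤b = reduced-≥0 B (inject₁<last x)

    b<N : lcos B y l < lsin A l
    b<N = subst (lcos B y l <_) (sym N≡M) (reduced-< B (inject₁<last x))

    N∣ : lsin A l ∣ s l * lcos A y l - lcos B y l * s y
    N∣ = subst (_∣ s l * lcos A y l - lcos B y l * s y) (sym N≡M)
      (last-lcos-congruent A B div-α div-β s w≡sv y (≢-sym Fin.fromℕ≢inject₁))

  lcos-π-same : lsin A l ∣ lcos A y l - lcos B y l → lcos B y l ≡ lcos A y l
  lcos-π-same N∣a-b = sym (residue-unique (reduced-≥0 A (inject₁<last x))
    (reduced-< A (inject₁<last x)) 0≤b b<N N∣a-b)

  -- A zero cosine in the last column would force N = 1, so N ≢ 1 yields the strict positivity
  -- needed for complements.
  lcos-π-complement : lsin A l ≢ 1ℤ → lsin A l ∣ lcos A y l + lcos B y l →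
    lcos B y l ≡ lsin A l - lcos A y l
  lcos-π-complement N≢1 = residue-complement
    (ℤ.≤∧≢⇒< (reduced-≥0 A (inject₁<last x)) (≢-sym a≢0))
    (reduced-< A (inject₁<last x)) 0≤b b<N
    where
    a≢0 : lcos A y l ≢ 0ℤ
    a≢0 a≡0 = N≢1 (zero⇒diagonal≡1 A div-α l (λ j → basis≗edge A div-α j) y a≡0)

  -- The signs are parameters because `flip` does not reduce at `fromℕ m` or `inject₁ x`.
  π-congruence : ∀ {t u} → flip i l ≡ t → flip i y ≡ u →
    lsin A l ∣ t * lcos A y l - lcos B y l * u
  π-congruence refl refl = N∣

-- The complement formulas assume N ≢ 1: for N = 1 reducedness makes both cosines 0, and the formula
-- would read 0 = 1.
proposition3p14 : ∀ {n m : ℕ} (α : Cone n (suc m)) → Simple α → (A : IARCTAN α) →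
    let k = fromℕ m in
    (∀ (i : Fin m) (B : IARCTAN (π inject₁ i − α)) (x : Fin m) →
    (x ≡ i → lsin A k ≢ 1ℤ →
    lcos B (inject₁ x) k ≡ lsin A k - lcos A (inject₁ x) k) ×
    (x ≢ i →
    lcos B (inject₁ x) k ≡ lcos A (inject₁ x) k))
    ×
    (∀ (B : IARCTAN (π k − α)) (x : Fin m) →
    lsin A k ≢ 1ℤ →
    lcos B (inject₁ x) k ≡ lsin A k - lcos A (inject₁ x) k)
proposition3p14 {m = m} α simple A =
  (λ i B x →
    (λ { refl N≢1 → lcos-π-complement α simple A (inject₁ i) B i N≢1
      (subst (lsin A last ∣_) (+,- (lcos A (inject₁ i) last) (lcos B (inject₁ i) last))
        (π-congruence α simple A (inject₁ i) B i
          (flip-other (last≢ i)) (flip-self (inject₁ i)))) }) ,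
    (λ x≢i → lcos-π-same α simple A (inject₁ i) B x
      (subst (lsin A last ∣_) (+,+ (lcos A (inject₁ x) last) (lcos B (inject₁ x) last))
        (π-congruence α simple A (inject₁ i) B x
          (flip-other (last≢ i)) (flip-other (x≢i ∘ Fin.inject₁-injective)))))) ,
  (λ B x N≢1 → lcos-π-complement α simple A last B x N≢1
    (subst (lsin A last ∣_) (-,+ (lcos A (inject₁ x) last) (lcos B (inject₁ x) last))
      -- Here the last edge carries the sign -1, so the congruence concerns -a - b and is negated.
      (∣m⇒∣-m (π-congruence α simple A last B x
        (flip-self last) (flip-other (≢-sym (last≢ x)))))))
  where
  last = fromℕ m
  last≢ : ∀ i → last ≢ inject₁ i
  last≢ i = Fin.fromℕ≢inject₁
  +,+ : ∀ a b → 1ℤ * a - b * 1ℤ ≡ a - b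
  +,+ = solve-∀
  +,- : ∀ a b → 1ℤ * a - b * -1ℤ ≡ a + b
  +,- = solve-∀
  -,+ : ∀ a b → - (-1ℤ * a - b * 1ℤ) ≡ a + b
  -,+ = solve-∀
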